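{- Let $\mathsf{L}$, $\mathsf{H}$ and $\mathsf{K}$ be simplicial complexes. Then $$\mathrm{C}(\mathsf{L};\mathsf{K})\leq \mathrm{C}(\mathsf{L};\mathsf{H})\cdot \mathrm{C}(\mathsf{H};\mathsf{K})\quad\text{and}\quad \mathrm{IC}(\mathsf{L};\mathsf{K})\leq \mathrm{IC}(\mathsf{L};\mathsf{H})\cdot \mathrm{IC}(\mathsf{H};\mathsf{K}).$$
   Context: A simplicial complex is an abstract simplicial complex: a set $\mathsf{K}$ of subsets (simplices) of a vertex set $V(\mathsf{K})=\bigcup\mathsf{K}$ such that $F\in\mathsf{K}$ and $G\subseteq F$ imply $G\in\mathsf{K}$. A facet is a simplex that is maximal with respect to inclusion; a facet is non-unitary if it has at least two vertices. A subcomplex of $\mathsf{K}$ is a simplicial complex contained in $\mathsf{K}$. The union of simplicial complexes is the union of their vertex sets and of their sets of simplices. A simplicial map $f:\mathsf{L}\to\mathsf{K}$ is a map $f:V(\mathsf{L})\to V(\mathsf{K})$ such that $f(F)\in\mathsf{K}$ whenever $F\in\mathsf{L}$; it is injective if it is injective on vertices. A facet simplicial map is a simplicial map $f:\mathsf{L}\to\mathsf{K}$ such that $f(F)$ is a non-unitary facet of $\mathsf{K}$ whenever $F$ is a non-unitary facet of $\mathsf{L}$. The facet-complexity $\mathrm{C}(\mathsf{L};\mathsf{K})$ is the least positive integer $k$ such that there exist subcomplexes $\mathsf{L}_1,\ldots,\mathsf{L}_k$ of $\mathsf{L}$ with $\mathsf{L}=\mathsf{L}_1\cup\cdots\cup\mathsf{L}_k$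 and, for each $i$, a facet simplicial map $f_i:\mathsf{L}_i\to\mathsf{K}$; it is $\infty$ if no such $k$ exists. The injective facet-complexity $\mathrm{IC}(\mathsf{L};\mathsf{K})$ is defined in the same way, requiring each $f_i$ to be an injective facet simplicial map. -}

module Defs where

open import Level using (Level) renaming (suc to lsuc)
open import Axiom.ExcludedMiddle using (ExcludedMiddle)
open import Data.Fin.Base using (Fin)
open import Data.Irrelevant using () renaming ([_] to irr)
open import Data.Nat.Base using (ℕ; zero; suc; _+_; _*_; _≤_; NonZero; z≤n)
open import Data.Nat.Properties using (+-identityʳ; +-suc; ≤∧≢⇒<)
open import Data.Product.Base using (Σ-syntax; ∃; ∃-syntax; _×_; _,_; proj₁)
open import Data.Refinement using (Refinement-syntax; value; _,_)
open import Function.Definitions using (Injective)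
open import Relation.Binary.PropositionalEquality.Core using (_≡_; _≢_; refl; sym; subst)
open import Relation.Nullary using (¬_; yes; no)
open import Relation.Nullary.Construct.Add.Supremum using (_⁺; [_]; ⊤⁺) public
open import Relation.Binary.Construct.Add.Supremum.NonStrict _≤_ using (_≤⁺_) public
open import Relation.Unary using (Pred; _∈_; _⊆_; _≐_; ⋃)

private
  variable
    ℓ : Level

-- Simplices are arbitrary subsets of the ambient type U; neither they nor the
-- complex are assumed finite or nonempty.  U itself is not the vertex set: it
-- only hosts the vertices, so a complex and its subcomplexes share the same U.

record SimplicialComplex {ℓ} (U : Set ℓ) : Set (lsuc (lsuc ℓ)) where
  field
    simplices   : Pred (Pred U ℓ) (lsuc ℓ)
    down-closed : ∀ {F G} → F ∈ simplices → G ⊆ F → G ∈ simplices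

open SimplicialComplex public

vertices : {U : Set ℓ} → SimplicialComplex U → Pred U (lsuc ℓ)
vertices K v = ∃[ F ] F ∈ simplices K × v ∈ F

-- The membership proof is irrelevant, so vertices of K are equal as soon as
-- their underlying elements of U are.

Vertex : {U : Set ℓ} → SimplicialComplex U → Set (lsuc ℓ)
Vertex {U = U} K = [ v ∈ U ∣ v ∈ vertices K ]

vertexOf : {U : Set ℓ} (K : SimplicialComplex U) {F : Pred U ℓ} →
           F ∈ simplices K → {v : U} → v ∈ F → Vertex K
vertexOf K F∈K {v} v∈F = v , irr (_ , F∈K , v∈F)

Facet : {U : Set ℓ} → SimplicialComplex U → Pred (Pred U ℓ) (lsuc ℓ)
Facet K F = F ∈ simplices K × (∀ {G} → G ∈ simplices K → F ⊆ G → G ⊆ F)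

NonUnitary : {U : Set ℓ} → Pred (Pred U ℓ) ℓ
NonUnitary F = ∃[ x ] ∃[ y ] x ∈ F × y ∈ F × x ≢ y

Subcomplex : {U : Set ℓ} → SimplicialComplex U → SimplicialComplex U → Set (lsuc ℓ)
Subcomplex M L = simplices M ⊆ simplices L

-- Only subsets F that are simplices of L have an image, since the map is
-- defined only on the vertices of L.

image : {U W : Set ℓ} {L : SimplicialComplex U} {K : SimplicialComplex W} →
        (Vertex L → Vertex K) → {F : Pred U ℓ} → F ∈ simplices L → Pred W ℓ
image {L = L} f {F} F∈L w =
  ∃[ v ] Σ[ v∈F ∈ v ∈ F ] value (f (vertexOf L F∈L v∈F)) ≡ w

IsSimplicial : {U W : Set ℓ} {L : SimplicialComplex U} {K : SimplicialComplex W} →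
               (Vertex L → Vertex K) → Set (lsuc ℓ)
IsSimplicial {L = L} {K} f =
  ∀ {F} (F∈L : F ∈ simplices L) → image {L = L} {K} f F∈L ∈ simplices K

PreservesFacets : {U W : Set ℓ} {L : SimplicialComplex U} {K : SimplicialComplex W} →
                  (Vertex L → Vertex K) → Set (lsuc ℓ)
PreservesFacets {L = L} {K} f =
  ∀ {F} (F-facet : Facet L F) → NonUnitary F →
  let fF = image {L = L} {K} f (proj₁ F-facet) in Facet K fF × NonUnitary fF

record FacetMap {ℓ} {U W : Set ℓ}
                (L : SimplicialComplex U) (K : SimplicialComplex W) : Set (lsuc ℓ) where
  field
    to               : Vertex L → Vertex K
    simplicial       : IsSimplicial {L = L} {K} to
    preserves-facets : PreservesFacets {L = L} {K} to

record InjectiveFacetMap {ℓ} {U W : Set ℓ}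
                         (L : SimplicialComplex U) (K : SimplicialComplex W) : Set (lsuc ℓ) where
  field
    facetMap : FacetMap L K
  open FacetMap facetMap public
  field
    injective : Injective _≡_ _≡_ to

Cover : {U : Set ℓ} → (SimplicialComplex U → Set (lsuc ℓ)) →
        SimplicialComplex U → ℕ → Set (lsuc (lsuc ℓ))
Cover {U = U} HasMap L k =
  Σ[ M ∈ (Fin k → SimplicialComplex U) ]
    (∀ i → Subcomplex (M i) L) ×
    simplices L ≐ ⋃[ i ∶ Fin k ] simplices (M i) ×
    (∀ i → HasMap (M i))

IsLeastPositive : ∀ {p} → Pred ℕ p → Pred (ℕ ⁺) p
IsLeastPositive P [ k ] = (NonZero k × P k) × (∀ {n} → NonZero n × P n → k ≤ n)
IsLeastPositive P ⊤⁺    = ∀ {n} → ¬ (NonZero n × P n)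

-- Existence of the least value is not constructive: it needs excluded middle.

least : ∀ {p} → ExcludedMiddle p → (P : Pred ℕ p) → ∃ (IsLeastPositive P)
least {p} em P with em {∃[ n ] NonZero n × P n}
... | no  ∄n       = ⊤⁺ , λ q → ∄n (_ , q)
... | yes (n , Qn) = search n 0 (subst Q (sym (+-identityʳ n)) Qn) (λ _ → z≤n)
  where
  Q : Pred ℕ p
  Q n = NonZero n × P n

  search : ∀ d k → Q (d + k) → (∀ {m} → Q m → k ≤ m) → ∃ (IsLeastPositive P)
  search zero    k Qk lb = [ k ] , Qk , lb
  search (suc d) k Qd lb with em {Q k}
  ... | yes Qk = [ k ] , Qk , lb
  ... | no ¬Qk = search d (suc k) (subst Q (sym (+-suc d k)) Qd)
                   (λ Qm → ≤∧≢⇒< (lb Qm) λ { refl → ¬Qk Qm })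

C : ExcludedMiddle (lsuc (lsuc ℓ)) → {U W : Set ℓ} →
    SimplicialComplex U → SimplicialComplex W → ℕ ⁺
C em L K = proj₁ (least em (Cover (λ M → FacetMap M K) L))

IC : ExcludedMiddle (lsuc (lsuc ℓ)) → {U W : Set ℓ} →
     SimplicialComplex U → SimplicialComplex W → ℕ ⁺
IC em L K = proj₁ (least em (Cover (λ M → InjectiveFacetMap M K) L))

-- Only used on values of C and IC, which are positive, so 0 · ∞ never arises.

infixl 7 _·_

_·_ : ℕ ⁺ → ℕ ⁺ → ℕ ⁺
[ m ] · [ n ] = [ m * n ]
[ _ ] · ⊤⁺    = ⊤⁺
⊤⁺    · _     = ⊤⁺

{-# OPTIONS --safe #-}

-- Given facet maps f i : L i → H on a cover of L and g j : N j → K on a cover of H,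
-- the composites g j ∘ f i live on the preimages of N j in L i.  Those may have new
-- facets, which f i need not send to facets.  So each finite cover is first shrunk
-- until every facet of a member is a facet of the whole: call a simplex stable if
-- every larger simplex lies in the same members of the cover.  By finiteness each
-- simplex is contained in a stable one, and the j-th member is replaced by the
-- complex generated by its stable simplices.  (Generating by facets would not do: an
-- infinite complex may have simplices that lie in no facet.)

module Submission where

open import Defs
open import Level using (Level; lift; lower) renaming (suc to lsuc)
open import Axiom.ExcludedMiddle using (ExcludedMiddle)
open import Data.Empty using (⊥-elim)
open import Data.Fin.Base using (Fin; zero; suc; combine; remQuot)
open import Data.Fin.Properties using (remQuot-combine)
import Data.Irrelevant as Irrelevant
open import Data.Nat.Base using (ℕ; zero; suc; _*_; _≤_)
open import Data.Nat.Properties using (m*n≢0)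
open import Data.Product.Base using (∃-syntax; Σ-syntax; _×_; _,_; proj₁; proj₂)
open import Data.Refinement using (value; _,_)
open import Data.Refinement.Properties using (value-injective)
open import Function.Base using (_∘_; id)
open import Relation.Binary.PropositionalEquality.Core using (refl; sym; cong; subst)
open import Relation.Binary.Construct.Add.Supremum.NonStrict _≤_ using ([_]; _≤⊤⁺)
open import Relation.Nullary using (Dec; yes; no)
open import Relation.Nullary.Decidable using (map′; decidable-stable)
open import Relation.Unary using (Pred; _∈_; _∉_; _⊆_; _≐_; ⋃)

private
  variable
    ℓ : Level
    U : Set ℓ

NonUnitary-⊆ : {F G : Pred U ℓ} → F ⊆ G → NonUnitary {U = U} F → NonUnitary G
NonUnitary-⊆ F⊆G (x , y , x∈F , y∈F , x≢y) = x , y , F⊆G x∈F , F⊆G y∈F , x≢y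

Facet-≐ : (K : SimplicialComplex {ℓ} U) {F G : Pred U ℓ} → F ≐ G → Facet K F → Facet K G
Facet-≐ K (F⊆G , G⊆F) (F∈K , max) =
  down-closed K F∈K G⊆F , λ E∈K G⊆E → F⊆G ∘ max E∈K (G⊆E ∘ F⊆G)

Facet-subcomplex : (M L : SimplicialComplex {ℓ} U) → Subcomplex M L →
                   {F : Pred U ℓ} → F ∈ simplices M → Facet L F → Facet M F
Facet-subcomplex M L M⊆L F∈M (_ , max) = F∈M , λ G∈M → max (M⊆L G∈M)

ReflectsFacets : SimplicialComplex {ℓ} U → SimplicialComplex U → Set (lsuc ℓ)
ReflectsFacets M L = Facet M ⊆ Facet L

module _ {U V W : Set ℓ} {L : SimplicialComplex U} {H : SimplicialComplex V}
         {K : SimplicialComplex W} where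

  -- Simplices are predicates, so the two images agree only up to mutual inclusion; `Facet-≐`
  -- carries facets across.
  image-∘ : (g : Vertex H → Vertex K) (f : Vertex L → Vertex H) {F : Pred U ℓ}
            (F∈L : F ∈ simplices L)
            (fF∈H : image {L = L} {H} f F∈L ∈ simplices H) →
            image {L = H} {K} g fF∈H ≐ image {L = L} {K} (g ∘ f) F∈L
  image-∘ g f F∈L fF∈H =
    (λ { (_ , (v , v∈F , refl) , refl) → v , v∈F , refl }) ,
    (λ { (v , v∈F , refl) → _ , (v , v∈F , refl) , refl })

  infixr 9 _∘ᶠ_ _∘ⁱ_

  _∘ᶠ_ : FacetMap H K → FacetMap L H → FacetMap L K
  g ∘ᶠ f = record
    { to               = g.to ∘ f.to
    ; simplicial       = λ F∈L →
        down-closed K (g.simplicial (f.simplicial F∈L))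
          (proj₂ (image-∘ g.to f.to F∈L (f.simplicial F∈L)))
    ; preserves-facets = λ F-facet F-nonUnitary →
        let fF-facet , fF-nonUnitary   = f.preserves-facets F-facet F-nonUnitary
            gfF-facet , gfF-nonUnitary = g.preserves-facets fF-facet fF-nonUnitary
            eq = image-∘ g.to f.to (proj₁ F-facet) (proj₁ fF-facet)
        in Facet-≐ K eq gfF-facet , NonUnitary-⊆ (proj₁ eq) gfF-nonUnitary
    }
    where
    module g = FacetMap g
    module f = FacetMap f

  _∘ⁱ_ : InjectiveFacetMap H K → InjectiveFacetMap L H → InjectiveFacetMap L K
  g ∘ⁱ f = record
    { facetMap  = g.facetMap ∘ᶠ f.facetMap
    ; injective = f.injective ∘ g.injective
    }
    where
    module g = InjectiveFacetMap g
    module f = InjectiveFacetMap f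

module _ {U V : Set ℓ} {L : SimplicialComplex U} {H : SimplicialComplex V} where

  preimage : FacetMap L H → SimplicialComplex V → SimplicialComplex U
  preimage f N = record
    { simplices   = λ F → Σ[ F∈L ∈ F ∈ simplices L ]
                            image {L = L} {H} (FacetMap.to f) F∈L ∈ simplices N
    ; down-closed = λ (F∈L , fF∈N) G⊆F →
        down-closed L F∈L G⊆F ,
        down-closed N fF∈N (λ (v , v∈G , eq) → v , G⊆F v∈G , eq)
    }

  module _ {M : SimplicialComplex U} {N : SimplicialComplex V} (N⊆H : Subcomplex N H) where

    -- A facet of `M` is a facet of `L`, so its image is a facet of `H`; lying in the smaller
    -- complex `N`, that image is maximal there too.
    restrict : (f : FacetMap L H) → Subcomplex M (preimage f N) → ReflectsFacets M L →
               FacetMap M N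
    restrict f M⊆f⁻¹N reflects = record
      { to = λ (v , v∈M) →
          value (f.to (v , Irrelevant.map (λ (F , F∈M , v∈F) → F , proj₁ (M⊆f⁻¹N F∈M) , v∈F) v∈M)) ,
          Irrelevant.map (λ (F , F∈M , v∈F) → _ , proj₂ (M⊆f⁻¹N F∈M) , v , v∈F , refl) v∈M
      ; simplicial = λ F∈M → proj₂ (M⊆f⁻¹N F∈M)
      ; preserves-facets = λ F-facet F-nonUnitary →
          let fF-facet , fF-nonUnitary = f.preserves-facets (reflects F-facet) F-nonUnitary
          in Facet-subcomplex N H N⊆H (proj₂ (M⊆f⁻¹N (proj₁ F-facet))) fF-facet , fF-nonUnitary
      }
      where module f = FacetMap f

    restrictⁱ : (f : InjectiveFacetMap L H) →
                Subcomplex M (preimage (InjectiveFacetMap.facetMap f) N) → ReflectsFacets M L →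
                InjectiveFacetMap M N
    restrictⁱ f M⊆f⁻¹N reflects = record
      { facetMap  = restrict f.facetMap M⊆f⁻¹N reflects
      ; injective = λ eq →
          value-injective (cong value (f.injective (value-injective (cong value eq))))
      }
      where module f = InjectiveFacetMap f

module Stabilisation (em : ExcludedMiddle (lsuc (lsuc ℓ))) {U : Set ℓ} (L : SimplicialComplex U) where

  -- For the simplices of `L` ordered by inclusion, these are the open and the dense sets of the
  -- topology of up-sets.
  UpClosed Cofinal : Pred (Pred U ℓ) (lsuc ℓ) → Set (lsuc ℓ)
  UpClosed P = ∀ {F G} → F ⊆ G → G ∈ simplices L → P F → P G
  Cofinal  P = ∀ {F} → F ∈ simplices L → ∃[ G ] G ∈ simplices L × F ⊆ G × P G

  -- Enlarge the simplex once for each condition; up-closure keeps the conditions already achieved.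
  -- This is where finiteness of the cover enters.
  cofinal-⋂ : ∀ {n} (P : Fin n → Pred (Pred U ℓ) (lsuc ℓ)) →
              (∀ j → UpClosed (P j)) → (∀ j → Cofinal (P j)) → Cofinal (λ F → ∀ j → P j F)
  cofinal-⋂ {zero}  P up cof {F} F∈L = F , F∈L , id , λ ()
  cofinal-⋂ {suc n} P up cof F∈L with cof zero F∈L
  ... | G , G∈L , F⊆G , PG with cofinal-⋂ (P ∘ suc) (up ∘ suc) (cof ∘ suc) G∈L
  ... | E , E∈L , G⊆E , PE = E , E∈L , G⊆E ∘ F⊆G , λ where
    zero    → up zero G⊆E E∈L PG
    (suc j) → PE j

  -- If `F` is not in `A`, no larger simplex is, by down-closure. So this one implication makes
  -- membership in `A` constant on the simplices of `L` above `F`.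
  StableIn : SimplicialComplex U → Pred (Pred U ℓ) (lsuc ℓ)
  StableIn A F = F ∈ simplices A → ∀ {G} → G ∈ simplices L → F ⊆ G → G ∈ simplices A

  stableIn-upClosed : ∀ A → UpClosed (StableIn A)
  stableIn-upClosed A F⊆G _ stable G∈A E∈L G⊆E =
    stable (down-closed A G∈A F⊆G) E∈L (G⊆E ∘ F⊆G)

  dec : (P : Set (lsuc ℓ)) → Dec P
  dec P = map′ lower lift (em {Level.Lift (lsuc (lsuc ℓ)) P})

  -- Either some larger simplex leaves `A`, and it is vacuously stable, or none does, and `F` itself
  -- is stable.
  stableIn-cofinal : ∀ A → Cofinal (StableIn A)
  stableIn-cofinal A {F} F∈L
    with dec (∃[ G ] G ∈ simplices L × F ⊆ G × G ∉ simplices A)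
  ... | yes (G , G∈L , F⊆G , G∉A) = G , G∈L , F⊆G , ⊥-elim ∘ G∉A
  ... | no ∄G = F , F∈L , id , λ _ {G} G∈L F⊆G →
    decidable-stable (dec (G ∈ simplices A)) (λ G∉A → ∄G (G , G∈L , F⊆G , G∉A))

  module _ {n} (A : Fin n → SimplicialComplex U) where

    Stable : Pred (Pred U ℓ) (lsuc ℓ)
    Stable F = ∀ j → StableIn (A j) F

    stablePart : Fin n → SimplicialComplex U
    stablePart j = record
      { simplices   = λ F → ∃[ G ] G ∈ simplices (A j) × Stable G × F ⊆ G
      ; down-closed = λ (E , E∈A , E-stable , F⊆E) G⊆F → E , E∈A , E-stable , F⊆E ∘ G⊆F
      }

    stablePart-⊆ : ∀ j → Subcomplex (stablePart j) (A j)
    stablePart-⊆ j (_ , G∈A , _ , F⊆G) = down-closed (A j) G∈A F⊆G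

    stablePart-covers : simplices L ⊆ ⋃[ j ∶ Fin n ] simplices (A j) →
                        simplices L ⊆ ⋃[ j ∶ Fin n ] simplices (stablePart j)
    stablePart-covers covers F∈L
      with cofinal-⋂ (StableIn ∘ A) (stableIn-upClosed ∘ A) (stableIn-cofinal ∘ A) F∈L
    ... | G , G∈L , F⊆G , G-stable with covers G∈L
    ... | j , G∈A = j , G , G∈A , G-stable , F⊆G

    -- A facet `F` of the stable part equals the stable `G` containing it. A simplex `E` of `L`
    -- above `F` is thus above `G`, hence in `A j` and stable, so it belongs to the stable part and
    -- maximality of `F` applies.
    stablePart-reflectsFacets : ∀ j → Subcomplex (A j) L → ReflectsFacets (stablePart j) L
    stablePart-reflectsFacets j A⊆L {F} (F∈M@(G , G∈A , G-stable , F⊆G) , max) =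
      A⊆L (stablePart-⊆ j F∈M) , λ {E} E∈L F⊆E →
        let G⊆E : G ⊆ E
            G⊆E = F⊆E ∘ max (G , G∈A , G-stable , id) F⊆G
            E-stable : Stable E
            E-stable = λ i → stableIn-upClosed (A i) G⊆E E∈L (G-stable i)
        in max (E , G-stable j G∈A E∈L G⊆E , E-stable , id) F⊆E

module _ (em : ExcludedMiddle (lsuc (lsuc ℓ))) {U V : Set ℓ}
         {L : SimplicialComplex U} {H : SimplicialComplex V}
         {P R : SimplicialComplex U → Set (lsuc ℓ)} {Q : SimplicialComplex V → Set (lsuc ℓ)}
         (facetMap : ∀ {A} → P A → FacetMap A H)
         (compose : ∀ {A M N} → Subcomplex N H → (f : P A) → Q N →
                    Subcomplex M (preimage (facetMap f) N) → ReflectsFacets M A → R M)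
         where

  -- With `P`, `Q` and `R` abstract, one construction serves plain and injective facet maps alike.
  cover-* : ∀ {m n} → Cover P L m → Cover Q H n → Cover R L (m * n)
  cover-* {m} {n} (A , A⊆L , (L⊆⋃A , _) , f) (N , N⊆H , (H⊆⋃N , _) , g) =
    (λ k → M (remQuot n k)) ,
    (λ k → M⊆L (remQuot n k)) ,
    (L⊆⋃M , λ (k , F∈M) → M⊆L (remQuot n k) F∈M) ,
    (λ k → M-map (remQuot n k))
    where
    -- Stabilisation takes place inside `A i`, not `L`, because `f i` preserves only the facets of
    -- its own domain.
    open module S i = Stabilisation em (A i)

    B : Fin m → Fin n → SimplicialComplex U
    B i j = preimage (facetMap (f i)) (N j)

    M : Fin m × Fin n → SimplicialComplex U
    M (i , j) = stablePart i (B i) j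

    M⊆L : ∀ k → Subcomplex (M k) L
    M⊆L (i , j) F∈M = A⊆L i (proj₁ (stablePart-⊆ i (B i) j F∈M))

    M-map : ∀ k → R (M k)
    M-map (i , j) = compose (N⊆H j) (f i) (g j) (stablePart-⊆ i (B i) j)
      (stablePart-reflectsFacets i (B i) j proj₁)

    B-covers : ∀ i → simplices (A i) ⊆ ⋃[ j ∶ Fin n ] simplices (B i j)
    B-covers i F∈A with H⊆⋃N (FacetMap.simplicial (facetMap (f i)) F∈A)
    ... | j , fF∈N = j , F∈A , fF∈N

    L⊆⋃M : simplices L ⊆ ⋃[ k ∶ Fin (m * n) ] simplices (M (remQuot n k))
    L⊆⋃M {F} F∈L with L⊆⋃A F∈L
    ... | i , F∈A with stablePart-covers i (B i) (B-covers i) F∈A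
    ... | j , F∈M =
      combine i j , subst (λ k → F ∈ simplices (M k)) (sym (remQuot-combine i j)) F∈M

-- An infinite factor leaves nothing to prove. Otherwise the witnesses at `m` and `n` give one for
-- `R` at the positive number `m * n`, which bounds a finite `x` and excludes an infinite one.
least-submultiplicative :
  ∀ {p} {P Q R : Pred ℕ p} → (∀ {m n} → P m → Q n → R (m * n)) →
  ∀ {x y z} → IsLeastPositive R x → IsLeastPositive P y → IsLeastPositive Q z → x ≤⁺ y · z
least-submultiplicative mul {_} {⊤⁺} _ _ _ = _ ≤⊤⁺
least-submultiplicative mul {_} {[ _ ]} {⊤⁺} _ _ _ = _ ≤⊤⁺
least-submultiplicative mul {[ _ ]} {[ m ]} {[ n ]} (_ , lb) ((m≢0 , Pm) , _) ((n≢0 , Qn) , _) =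
  [ lb (m*n≢0 m n {{m≢0}} {{n≢0}} , mul Pm Qn) ]
least-submultiplicative mul {⊤⁺} {[ m ]} {[ n ]} none ((m≢0 , Pm) , _) ((n≢0 , Qn) , _) =
  ⊥-elim (none (m*n≢0 m n {{m≢0}} {{n≢0}} , mul Pm Qn))

theorem3p7 : ∀ {ℓ : Level} (em : ExcludedMiddle (lsuc (lsuc ℓ))) {U V W : Set ℓ}
    (L : SimplicialComplex U) (H : SimplicialComplex V) (K : SimplicialComplex W) →
    (C em L K ≤⁺ C em L H · C em H K) × (IC em L K ≤⁺ IC em L H · IC em H K)
theorem3p7 em L H K =
  least-submultiplicative
    (cover-* em {L = L} {H} {R = λ M → FacetMap M K} id λ {A} {M} {N} N⊆H f g M⊆f⁻¹N reflects →
      _∘ᶠ_ {L = M} {N} {K} g (restrict {L = A} {H} {M} {N} N⊆H f M⊆f⁻¹N reflects))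
    (proj₂ (least em _)) (proj₂ (least em _)) (proj₂ (least em _)) ,
  least-submultiplicative
    (cover-* em {L = L} {H} {R = λ M → InjectiveFacetMap M K} InjectiveFacetMap.facetMap
      λ {A} {M} {N} N⊆H f g M⊆f⁻¹N reflects →
      _∘ⁱ_ {L = M} {N} {K} g (restrictⁱ {L = A} {H} {M} {N} N⊆H f M⊆f⁻¹N reflects))
    (proj₂ (least em _)) (proj₂ (least em _)) (proj₂ (least em _))
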